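{- For $w\in S_n$, the following are equivalent: (i) $w$ is $1432$-avoiding; (ii) $\mathsf{SKKoh}(w)=\mathsf{KKoh}(w)$.
   Context: Cells of $[n]\times[n]$ are indexed in matrix notation: $(i,j)$ is row $i$ (from the top), column $j$ (from the left). A permutation $w$ is $1432$-avoiding if there are no indices $j_1<j_2<j_3<j_4$ with $w(j_1)<w(j_4)<w(j_3)<w(j_2)$. The Rothe diagram of $w\in S_n$ is $D(w)=\{(i,j)\in[n]^2: i<w^{ -1}(j),\ j<w(i)\}$. A grave diagram is a pair $E=(B,G)$ of disjoint subsets of $[n]\times[n]$; cells of $B$ are boxes, cells of $G$ are ghosts, cells of $B\cup G$ are occupied. Suppose $(i,j)\in B$ is rightmost among all occupied cells in row $i$; let $i'=\max\{r: 1\leq r<i,\ (r,j)\notin B\cup G\}$; assume $i'$ exists and every occupied cell $(r,j)$ with $i'<r\leq i$ is a box. The ordinary Kohnert move at row $i$ is $(B,G)\mapsto((B\setminus\{(i,j)\})\cup\{(i',j)\},G)$; the $K$-Kohnert move at row $i$ is $(B,G)\mapsto((B\setminus\{(i,j)\})\cup\{(i',j)\},G\cup\{(i,j)\})$. Such a move is simple if it shifts the box upward by exactly one row, i.e. $i'=i-1$. $\mathsf{KKoh}(w)$ is the closure of $(D(w),\varnothing)$ under ordinary and $K$-Kohnert moves; $\mathsf{SKKoh}(w)$ is the closure of $(D(w),\varnothing)$ under simple ordinary and simple $K$-Kohnert moves. -}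

module Defs where

open import Data.Bool using (true)
open import Data.Fin using (Fin; toℕ; _<_; _≤_; combine; remQuot)
open import Data.Fin.Permutation using (Permutation′; _⟨$⟩ʳ_; _⟨$⟩ˡ_)
open import Data.Fin.Properties using (_<?_; remQuot-combine)
open import Data.Fin.Subset using (Subset; ⊥; ⁅_⁆; _∈_; _∉_; _∪_; _-_)
open import Data.Fin.Subset.Properties using (∉⊥)
open import Data.Nat using (ℕ; suc; _*_)
open import Data.Product using (_×_; _,_; ∃-syntax; uncurry)
open import Data.Vec using (tabulate)
open import Data.Vec.Properties using ([]=⇒lookup; lookup⇒[]=; lookup∘tabulate)
open import Function using (_∘_; _⇔_; mk⇔)
open import Level using (0ℓ)
open import Relation.Binary using (Rel)
open import Relation.Binary.Construct.Closure.ReflexiveTransitive using (Star)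
open import Relation.Binary.PropositionalEquality using (_≡_; sym; trans; cong)
open import Relation.Nullary using (¬_; Dec; yes; does; _×-dec_)
open import Relation.Nullary.Decidable using (dec-true)
open import Relation.Unary using (Pred)

Avoids1432 : ∀ {n} → Permutation′ n → Set
Avoids1432 w =
  ¬ (∃[ j₁ ] ∃[ j₂ ] ∃[ j₃ ] ∃[ j₄ ]
       (j₁ < j₂ × j₂ < j₃ × j₃ < j₄) ×
       (w ⟨$⟩ʳ j₁ < w ⟨$⟩ʳ j₄ × w ⟨$⟩ʳ j₄ < w ⟨$⟩ʳ j₃ × w ⟨$⟩ʳ j₃ < w ⟨$⟩ʳ j₂))

-- The grid [n] × [n] is encoded as Fin (n * n) through the bijection combine,
-- so that sets of cells are Data.Fin.Subset's and have extensional equality.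
-- Indices are 0-based; row 0 is the top row and column 0 the leftmost column.

CellSet : ℕ → Set
CellSet n = Subset (n * n)

cell : ∀ {n} → Fin n → Fin n → Fin (n * n)
cell = combine

InRothe : ∀ {n} → Permutation′ n → Fin n → Fin n → Set
InRothe w i j = i < w ⟨$⟩ˡ j × j < w ⟨$⟩ʳ i

inRothe? : ∀ {n} (w : Permutation′ n) i j → Dec (InRothe w i j)
inRothe? w i j = (i <? w ⟨$⟩ˡ j) ×-dec (j <? w ⟨$⟩ʳ i)

rothe : ∀ {n} → Permutation′ n → CellSet n
rothe {n} w = tabulate (λ c → does (uncurry (inRothe? w) (remQuot n c)))

∈-rothe : ∀ {n} (w : Permutation′ n) i j → cell i j ∈ rothe w ⇔ InRothe w i j
∈-rothe {n} w i j = mk⇔ to from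
  where
  lookup-rothe = trans
    (lookup∘tabulate (λ c → does (uncurry (inRothe? w) (remQuot n c))) (cell i j))
    (cong (does ∘ uncurry (inRothe? w)) (remQuot-combine {n} i j))

  does⇒ : ∀ {P : Set} (P? : Dec P) → does P? ≡ true → P
  does⇒ (yes p) _ = p

  to : cell i j ∈ rothe w → InRothe w i j
  to c∈ = does⇒ (inRothe? w i j) (trans (sym lookup-rothe) ([]=⇒lookup c∈))

  from : InRothe w i j → cell i j ∈ rothe w
  from p = lookup⇒[]= _ _ (trans lookup-rothe (dec-true (inRothe? w i j) p))

-- Disjointness is an irrelevant field, so two grave diagrams are equal
-- as soon as they have the same boxes and the same ghosts.
record GraveDiagram (n : ℕ) : Set where
  constructor grave
  field
    boxes     : CellSet n
    ghosts    : CellSet n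
    .disjoint : ∀ c → c ∈ boxes → c ∉ ghosts

  occupied : CellSet n
  occupied = boxes ∪ ghosts

open GraveDiagram public

initial : ∀ {n} → Permutation′ n → GraveDiagram n
initial w = grave (rothe w) ⊥ (λ _ _ → ∉⊥)

IsMax : ∀ {n} → Pred (Fin n) 0ℓ → Fin n → Set
IsMax P m = P m × (∀ r → P r → r ≤ m)

record Movable {n} (E : GraveDiagram n) (i j i′ : Fin n) : Set where
  field
    box        : cell i j ∈ boxes E
    rightmost  : IsMax (λ k → cell i k ∈ occupied E) j
    target     : IsMax (λ r → r < i × cell r j ∉ occupied E) i′
    boxes-only : ∀ r → i′ < r → r ≤ i →
                 cell r j ∈ occupied E → cell r j ∈ boxes E

-- A move at row i is a partial map; Move i i′ is its graph, restricted to
-- moves that shift the box from row i to row i′.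
data Move {n} (i i′ : Fin n) (E E′ : GraveDiagram n) : Set where
  ordinary : ∀ {j} → Movable E i j i′ →
             boxes E′ ≡ (boxes E - cell i j) ∪ ⁅ cell i′ j ⁆ →
             ghosts E′ ≡ ghosts E →
             Move i i′ E E′
  K-move   : ∀ {j} → Movable E i j i′ →
             boxes E′ ≡ (boxes E - cell i j) ∪ ⁅ cell i′ j ⁆ →
             ghosts E′ ≡ ghosts E ∪ ⁅ cell i j ⁆ →
             Move i i′ E E′

AnyMove : ∀ {n} → Rel (GraveDiagram n) 0ℓ
AnyMove E E′ = ∃[ i ] ∃[ i′ ] Move i i′ E E′

SimpleMove : ∀ {n} → Rel (GraveDiagram n) 0ℓ
SimpleMove E E′ = ∃[ i ] ∃[ i′ ] Move i i′ E E′ × toℕ i ≡ suc (toℕ i′)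

KKoh : ∀ {n} → Permutation′ n → Pred (GraveDiagram n) 0ℓ
KKoh w = Star AnyMove (initial w)

SKKoh : ∀ {n} → Permutation′ n → Pred (GraveDiagram n) 0ℓ
SKKoh w = Star SimpleMove (initial w)

{-# OPTIONS --safe #-}
{-
Let w avoid 1432. Number the boxes of each column from top to bottom, so that a jump over a stack
of boxes becomes a shift of the whole stack by one row, and let pos i j be the current row of the box
that started in (i , j). If (i , j) and (i , k) with j < k both start as boxes and the left one has
moved, then the right one and all of its ghosts are weakly above it. Avoidance of 1432 is what keeps
this staircase condition invariant under all moves. Conversely, a diagram satisfying it is reached by
simple moves, each box climbing to its final row in turn: rows from top to bottom, right to left in a row.

If j₁ < j₂ < j₃ < j₄ is a 1432 pattern, let b = w j₃ and let a be the last column of the Rothe diagram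
in row j₃. Ordinary moves bring the box (j₃ , a) above row j₂ while column b stays untouched. Simple
moves cannot do this, since the box (j₂ , a) is blocked for as long as the box (j₂ , b) has not moved.
-}

module Submission where

open import Defs
open import Data.Bool using (if_then_else_; _∧_)
open import Data.Empty.Irrelevant using () renaming (⊥-elim to ⊥-elim-irr)
open import Data.Fin using (Fin; zero; suc; toℕ; fromℕ<) renaming (_<_ to _<ᶠ_)
open import Data.Fin.Permutation using (Permutation′; _⟨$⟩ʳ_; _⟨$⟩ˡ_; inverseˡ; inverseʳ)
open import Data.Fin.Properties
  using (any?; toℕ-injective; toℕ<n; toℕ≤n; toℕ-fromℕ<; combine-injective; combine-surjective)
  renaming (_≟_ to _≟ᶠ_)
open import Data.Fin.Subset using (Subset; ⁅_⁆; _∈_; _∉_; _∪_; _-_; ∣_∣) renaming (⊥ to ∅)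
open import Data.Fin.Subset.Properties
  using (_∈?_; ∉⊥; x∈⁅x⁆; x∈⁅y⁆⇒x≡y; ⊆-antisym; x∈p∪q⁻; x∈p∪q⁺; p─q⊆p; p─q─q≡p─q;
         x∈p∧x≢y⇒x∈p-y; x∈p⇒∣p-x∣<∣p∣)
open import Data.Nat using (ℕ; zero; suc; pred; _≤_; _<_; z≤n; s≤s; _∸_; _+_; _<?_; _≤?_)
open import Data.Nat.Properties
open import Data.Product using (_×_; _,_; proj₁; proj₂; ∃-syntax; Σ-syntax)
open import Data.Sum using (_⊎_; inj₁; inj₂; [_,_]′)
open import Function using (_∘_; _⇔_; mk⇔; Equivalence)
open import Level using (0ℓ)
open import Relation.Binary.Construct.Closure.ReflexiveTransitive as Star using (Star; ε; _◅_; _◅◅_)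
open import Relation.Binary.Definitions using (tri<; tri≈; tri>)
open import Relation.Binary.PropositionalEquality
  using (_≡_; _≢_; refl; sym; trans; cong; subst; subst₂)
open import Relation.Nullary using (¬_; ¬?; Dec; yes; no; does; contradiction; _×-dec_)
open import Relation.Nullary.Decidable using (decidable-stable)
open import Relation.Unary using (Pred; Decidable; _≐_)

private
  variable
    n m : ℕ

-- Subsets with a point removed, inserted or replaced.

x∉p-x : ∀ (p : Subset m) x → x ∉ p - x
x∉p-x p x x∈ = <-irrefl (cong ∣_∣ (p─q─q≡p─q p ⁅ x ⁆)) (x∈p⇒∣p-x∣<∣p∣ x∈)

x∈p-y⁻ : ∀ (p : Subset m) {x} y → x ∈ p - y → x ∈ p × x ≢ y
x∈p-y⁻ p y x∈ = p─q⊆p p ⁅ y ⁆ x∈ , λ { refl → x∉p-x p y x∈ }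

∈-insert⁻ : ∀ (p : Subset m) {x} y → x ∈ p ∪ ⁅ y ⁆ → x ∈ p ⊎ x ≡ y
∈-insert⁻ p y x∈ with x∈p∪q⁻ p ⁅ y ⁆ x∈
... | inj₁ x∈p = inj₁ x∈p
... | inj₂ x∈y = inj₂ (x∈⁅y⁆⇒x≡y y x∈y)

∈-insertˡ : ∀ {p : Subset m} {x y} → x ∈ p → x ∈ p ∪ ⁅ y ⁆
∈-insertˡ = x∈p∪q⁺ ∘ inj₁

∈-insertʳ : ∀ {p : Subset m} {y} → y ∈ p ∪ ⁅ y ⁆
∈-insertʳ = x∈p∪q⁺ (inj₂ (x∈⁅x⁆ _))

∈-replace⁻ : ∀ (p : Subset m) {x} y z → x ∈ (p - y) ∪ ⁅ z ⁆ → (x ∈ p × x ≢ y) ⊎ x ≡ z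
∈-replace⁻ p y z x∈ with ∈-insert⁻ (p - y) z x∈
... | inj₁ x∈p-y = inj₁ (x∈p-y⁻ p y x∈p-y)
... | inj₂ x≡z   = inj₂ x≡z

p-y-absent : ∀ {p : Subset m} {y} → y ∉ p → p - y ≡ p
p-y-absent {p = p} {y} y∉p =
  ⊆-antisym (p─q⊆p p ⁅ y ⁆) (λ x∈ → x∈p∧x≢y⇒x∈p-y x∈ λ { refl → y∉p x∈ })

remove-insert : ∀ {p : Subset m} {y} → y ∈ p → (p - y) ∪ ⁅ y ⁆ ≡ p
remove-insert {p = p} {y} y∈p = ⊆-antisym to from
  where
  to : ∀ {x} → x ∈ (p - y) ∪ ⁅ y ⁆ → x ∈ p
  to x∈ with ∈-replace⁻ p y y x∈
  ... | inj₁ (x∈p , _) = x∈p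
  ... | inj₂ refl      = y∈p
  from : ∀ {x} → x ∈ p → x ∈ (p - y) ∪ ⁅ y ⁆
  from {x} x∈ with x ≟ᶠ y
  ... | yes refl = ∈-insertʳ
  ... | no x≢y   = ∈-insertˡ (x∈p∧x≢y⇒x∈p-y x∈ x≢y)

replace-replace : ∀ {p : Subset m} {y z} → y ∈ p → z ∉ p →
                  (((p - y) ∪ ⁅ z ⁆) - z) ∪ ⁅ y ⁆ ≡ p
replace-replace {p = p} {y} {z} y∈p z∉p = ⊆-antisym to from
  where
  to : ∀ {x} → x ∈ (((p - y) ∪ ⁅ z ⁆) - z) ∪ ⁅ y ⁆ → x ∈ p
  to x∈ with ∈-replace⁻ ((p - y) ∪ ⁅ z ⁆) z y x∈
  ... | inj₂ refl = y∈p
  ... | inj₁ (x∈′ , x≢z) with ∈-replace⁻ p y z x∈′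
  ...   | inj₁ (x∈p , _) = x∈p
  ...   | inj₂ x≡z       = contradiction x≡z x≢z
  from : ∀ {x} → x ∈ p → x ∈ (((p - y) ∪ ⁅ z ⁆) - z) ∪ ⁅ y ⁆
  from {x} x∈ with x ≟ᶠ y
  ... | yes refl = ∈-insertʳ
  ... | no x≢y   = ∈-insertˡ (x∈p∧x≢y⇒x∈p-y (∈-insertˡ (x∈p∧x≢y⇒x∈p-y x∈ x≢y))
                                             λ { refl → z∉p x∈ })

-- Cells of a grave diagram.

Box Ghost Occupied : GraveDiagram n → Fin n → Fin n → Set
Box      E i j = cell i j ∈ boxes E
Ghost    E i j = cell i j ∈ ghosts E
Occupied E i j = cell i j ∈ occupied E

box⇒occupied : ∀ (E : GraveDiagram n) {i j} → Box E i j → Occupied E i j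
box⇒occupied E = x∈p∪q⁺ ∘ inj₁

ghost⇒occupied : ∀ (E : GraveDiagram n) {i j} → Ghost E i j → Occupied E i j
ghost⇒occupied E = x∈p∪q⁺ ∘ inj₂

occupied⇒ : ∀ (E : GraveDiagram n) {i j} → Occupied E i j → Box E i j ⊎ Ghost E i j
occupied⇒ E = x∈p∪q⁻ (boxes E) (ghosts E)

box-not-ghost : ∀ (E : GraveDiagram n) {c} → c ∈ boxes E → c ∉ ghosts E
box-not-ghost (grave _ _ d) b∈ g∈ = ⊥-elim-irr (d _ b∈ g∈)

cell-injective : ∀ {i j k l : Fin n} → cell i j ≡ cell k l → i ≡ k × j ≡ l
cell-injective {i = i} {j} {k} {l} = combine-injective i j k l

∈-replace-cell⁻ : ∀ (p : CellSet n) {s k i i′ j : Fin n} → cell s k ∈ (p - cell i j) ∪ ⁅ cell i′ j ⁆ →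
                  (cell s k ∈ p × ¬ (s ≡ i × k ≡ j)) ⊎ (s ≡ i′ × k ≡ j)
∈-replace-cell⁻ p {i = i} {i′} {j} c∈ with ∈-replace⁻ p (cell i j) (cell i′ j) c∈
... | inj₁ (c∈p , c≢) = inj₁ (c∈p , λ { (refl , refl) → c≢ refl })
... | inj₂ c≡         = inj₂ (cell-injective c≡)

∈-replace-cell⁺ : ∀ {p : CellSet n} {s k i i′ j : Fin n} → cell s k ∈ p → ¬ (s ≡ i × k ≡ j) →
                  cell s k ∈ (p - cell i j) ∪ ⁅ cell i′ j ⁆
∈-replace-cell⁺ c∈ ≢ = ∈-insertˡ (x∈p∧x≢y⇒x∈p-y c∈ (≢ ∘ cell-injective))

grave-≡ : ∀ {E E′ : GraveDiagram n} → boxes E ≡ boxes E′ → ghosts E ≡ ghosts E′ → E ≡ E′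
grave-≡ {E = grave b g _} {grave .b .g _} refl refl = refl

cells-≡ : ∀ {p q : CellSet n} →
          (∀ i j → cell i j ∈ p → cell i j ∈ q) → (∀ i j → cell i j ∈ q → cell i j ∈ p) → p ≡ q
cells-≡ {n} {p} {q} p⊆q q⊆p = ⊆-antisym (on-cells p⊆q) (on-cells q⊆p)
  where
  on-cells : ∀ {p q : CellSet n} → (∀ i j → cell i j ∈ p → cell i j ∈ q) → ∀ {c} → c ∈ p → c ∈ q
  on-cells p⊆q {c} c∈ with combine-surjective {n} {n} c
  ... | i , j , refl = p⊆q i j c∈

-- The effect of a single move on the cells.

-- `ghost-cases` allows a new ghost at `(i , j)` without demanding one, so ordinary and K-moves
-- share this interface.
record Slide (i i′ j : Fin n) (E E′ : GraveDiagram n) : Set where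
  field
    movable     : Movable E i j i′
    box-cases   : ∀ {s k} → Box E′ s k → (Box E s k × ¬ (s ≡ i × k ≡ j)) ⊎ (s ≡ i′ × k ≡ j)
    box-stays   : ∀ {s k} → Box E s k → ¬ (s ≡ i × k ≡ j) → Box E′ s k
    box-lands   : Box E′ i′ j
    ghost-cases : ∀ {g k} → Ghost E′ g k → Ghost E g k ⊎ (g ≡ i × k ≡ j)
    ghost-stays : ∀ {g k} → Ghost E g k → Ghost E′ g k

  open Movable movable public

  upward : toℕ i′ < toℕ i
  upward = proj₁ (proj₁ target)

  target-empty : ¬ Occupied E i′ j
  target-empty = proj₂ (proj₁ target)

  -- Maximality of `i′` rules out empty cells strictly between `i′` and `i`, and `boxes-only` rules
  -- out ghosts there.
  boxes-between : ∀ {r} → toℕ i′ < toℕ r → toℕ r ≤ toℕ i → Box E r j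
  boxes-between {r} i′<r r≤i with r ≟ᶠ i
  ... | yes refl = box
  ... | no r≢i   = boxes-only r i′<r r≤i (decidable-stable (_ ∈? occupied E) λ r∉ →
    <⇒≱ i′<r (proj₂ target r (≤∧≢⇒< r≤i (r≢i ∘ toℕ-injective) , r∉)))

  right-empty : ∀ {k} → toℕ j < toℕ k → ¬ Occupied E i k
  right-empty j<k i,k∈ = <⇒≱ j<k (proj₂ rightmost _ i,k∈)

slide : ∀ {i i′} {E E′ : GraveDiagram n} → Move i i′ E E′ → ∃[ j ] Slide i i′ j E E′
slide {E = grave b _ _} {grave _ _ _} (ordinary {j} mv refl refl) = j , record
  { movable     = mv
  ; box-cases   = ∈-replace-cell⁻ b
  ; box-stays   = ∈-replace-cell⁺
  ; box-lands   = ∈-insertʳ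
  ; ghost-cases = inj₁
  ; ghost-stays = λ g∈ → g∈
  }
slide {i = i} {E = grave b g _} {grave _ _ _} (K-move {j} mv refl refl) = j , record
  { movable     = mv
  ; box-cases   = ∈-replace-cell⁻ b
  ; box-stays   = ∈-replace-cell⁺
  ; box-lands   = ∈-insertʳ
  ; ghost-cases = λ g∈ → [ inj₁ , inj₂ ∘ cell-injective ]′ (∈-insert⁻ g (cell i j) g∈)
  ; ghost-stays = ∈-insertˡ
  }

-- Rothe diagrams and the tracking invariant.

module _ (w : Permutation′ n) where

  -- The northwest property of Rothe diagrams; it supplies the corner `(u , j)` from which
  -- `complete-or-full` starts.
  rothe-left : ∀ {u i j k : Fin n} → InRothe w u k → InRothe w i j →
               toℕ u < toℕ i → toℕ j < toℕ k → InRothe w u j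
  rothe-left (_ , k<wu) (i<wj , _) u<i j<k = <-trans u<i i<wj , <-trans j<k k<wu

  -- If both disjuncts fail, a missing cell (s , j) gives the entry 1, row u the entry 4,
  -- and the missing cell (i , k) the entry 3 of a 1432 pattern whose entry 2 has value j.
  complete-or-full : Avoids1432 w → ∀ {u i j k : Fin n} →
                     InRothe w u j → InRothe w u k → InRothe w i j →
                     toℕ u < toℕ i → toℕ j < toℕ k →
                     InRothe w i k ⊎ (∀ s → toℕ s ≤ toℕ u → InRothe w s j)
  complete-or-full avoids {u} {i} {j} {k} u,j∈@(u<wj , _) (u<wk , k<wu) (i<wj , j<wi) u<i j<k
    with inRothe? w i k
  ... | yes d = inj₁ d
  ... | no ¬d = inj₂ λ s s≤u → decidable-stable (inRothe? w s j) (excluded s s≤u)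
    where
    j₄ = w ⟨$⟩ˡ j
    wj₄ : toℕ (w ⟨$⟩ʳ j₄) ≡ toℕ j
    wj₄ = cong toℕ (inverseʳ w)
    excluded : ∀ s → toℕ s ≤ toℕ u → ¬ ¬ InRothe w s j
    excluded s s≤u ¬s = avoids (s , u , third (toℕ k <? toℕ (w ⟨$⟩ʳ i)))
      where
      s<u : toℕ s < toℕ u
      s<u = ≤∧≢⇒< s≤u λ eq → ¬s (subst (λ r → InRothe w r j) (sym (toℕ-injective eq)) u,j∈)
      s<wj : toℕ s < toℕ j₄
      s<wj = <-trans s<u u<wj
      ws<j : toℕ (w ⟨$⟩ʳ s) < toℕ j
      ws<j = ≤∧≢⇒< (≮⇒≥ λ j<ws → ¬s (s<wj , j<ws)) λ eq →
        <-irrefl (cong toℕ (trans (sym (inverseˡ w)) (cong (w ⟨$⟩ˡ_) (toℕ-injective eq)))) s<wj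
      ws<wj₄ = subst (toℕ (w ⟨$⟩ʳ s) <_) (sym wj₄) ws<j
      -- The cell `(i , k)` is missing for one of two reasons. Either value `k` occurs at a position
      -- at most `i`, and is itself entry 3, or `w i` is at most `k`, and position `i` carries entry
      -- 3.
      third : Dec (toℕ k < toℕ (w ⟨$⟩ʳ i)) → _
      third (yes k<wi) = w ⟨$⟩ˡ k , j₄
        , (s<u , u<wk , ≤-<-trans (≮⇒≥ λ i<wk → ¬d (i<wk , k<wi)) i<wj)
        , (ws<wj₄ , subst₂ _<_ (sym wj₄) wk j<k , subst (_< _) wk k<wu)
        where wk = cong toℕ (sym (inverseʳ w))
      third (no k≮wi) = i , j₄ , (s<u , u<i , i<wj)
        , (ws<wj₄ , subst (_< _) (sym wj₄) j<wi , ≤-<-trans (≮⇒≥ k≮wi) k<wu)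

  -- Box (i , j) of the Rothe diagram left the ghost (g , j) behind.
  record Owns (E : GraveDiagram n) (pos : Fin n → Fin n → ℕ) (i j g : Fin n) : Set where
    field
      ghost  : Ghost E g j
      passed : pos i j < toℕ g
      start  : toℕ g ≤ toℕ i
      -- This makes the owner the lowest box of the column above row `g`, so a ghost has only one
      -- owner.
      next   : ∀ {i′} → InRothe w i′ j → toℕ i < toℕ i′ → toℕ g < pos i′ j

  -- pos i j is the current row of the box that started in cell (i , j), under the convention
  -- that the boxes of a column never overtake one another.
  record Tracking (E : GraveDiagram n) : Set where
    field
      pos         : Fin n → Fin n → ℕ
      pos-≤       : ∀ {i j} → InRothe w i j → pos i j ≤ toℕ i
      pos-mono    : ∀ {i i′ j} → InRothe w i j → InRothe w i′ j → toℕ i < toℕ i′ → pos i j < pos i′ j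
      box-origin  : ∀ {s j} → Box E s j → ∃[ i ] InRothe w i j × pos i j ≡ toℕ s
      pos-box     : ∀ {s i j} → InRothe w i j → pos i j ≡ toℕ s → Box E s j
      ghost-owner : ∀ {g j} → Ghost E g j → ∃[ i ] InRothe w i j × Owns E pos i j g
      staircase   : ∀ {i j k} → toℕ j < toℕ k → InRothe w i j → InRothe w i k →
                    pos i j ≡ toℕ i ⊎
                    (pos i k ≤ pos i j × (∀ g → Owns E pos i k g → toℕ g ≤ pos i j))

    -- `pos` increases strictly along a column, so a column filled to the top leaves its boxes no
    -- room to rise.
    pos-full : ∀ {u j} → (∀ s → toℕ s ≤ toℕ u → InRothe w s j) → toℕ u ≤ pos u j
    pos-full {u} {j} full = go (toℕ u) u refl ≤-refl
      where
      go : ∀ t s → toℕ s ≡ t → toℕ s ≤ toℕ u → t ≤ pos s j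
      go zero    s eq s≤u = z≤n
      go (suc t) s eq s≤u = ≤-<-trans (go t s′ s′≡t (≤-trans (<⇒≤ s′<s) s≤u))
                                      (pos-mono (full s′ (≤-trans (<⇒≤ s′<s) s≤u)) (full s s≤u) s′<s)
        where
        t<n : t < n
        t<n = <-trans (≤-reflexive (sym eq)) (toℕ<n s)
        s′ = fromℕ< t<n
        s′≡t = toℕ-fromℕ< t<n
        s′<s : toℕ s′ < toℕ s
        s′<s = ≤-reflexive (trans (cong suc s′≡t) (sym eq))

    pos-injective : ∀ {u v j} → InRothe w u j → InRothe w v j → pos u j ≡ pos v j → u ≡ v
    pos-injective {u} {v} u∈ v∈ eq with <-cmp (toℕ u) (toℕ v)
    ... | tri< u<v _ _ = contradiction eq (<⇒≢ (pos-mono u∈ v∈ u<v))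
    ... | tri≈ _ u≡v _ = toℕ-injective u≡v
    ... | tri> _ _ v<u = contradiction (sym eq) (<⇒≢ (pos-mono v∈ u∈ v<u))

    pos-reflects-< : ∀ {u v j} → InRothe w u j → InRothe w v j → pos u j < pos v j → toℕ u < toℕ v
    pos-reflects-< {u} {v} u∈ v∈ lt with <-cmp (toℕ u) (toℕ v)
    ... | tri< u<v _ _ = u<v
    ... | tri≈ _ u≡v _ rewrite toℕ-injective u≡v = contradiction lt (<-irrefl refl)
    ... | tri> _ _ v<u = contradiction lt (<-asym (pos-mono v∈ u∈ v<u))

  initial-tracking : Tracking (initial w)
  initial-tracking = record
    { pos         = λ i _ → toℕ i
    ; pos-≤       = λ _ → ≤-refl
    ; pos-mono    = λ _ _ i<i′ → i<i′
    ; box-origin  = λ b∈ → _ , Equivalence.to (∈-rothe w _ _) b∈ , refl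
    ; pos-box     = λ {s} {i} {j} d eq →
        Equivalence.from (∈-rothe w s j) (subst (λ r → InRothe w r j) (toℕ-injective eq) d)
    ; ghost-owner = λ g∈ → contradiction g∈ ∉⊥
    ; staircase   = λ _ _ _ → inj₁ refl
    }

-- Raising an interval of rows by one.

-- The decisions are arguments so that `shift-view` can match on them.
shift-when : ∀ {a b x} → Dec (a < x) → Dec (x ≤ b) → ℕ
shift-when {x = x} (yes _) (yes _) = pred x
shift-when {x = x} _       _       = x

shift : ℕ → ℕ → ℕ → ℕ
shift a b x = shift-when (a <? x) (x ≤? b)

-- `rises` exhibits the old row as a successor, which removes `pred` and its value at `zero`.
data ShiftView (a b x : ℕ) : ℕ → Set where
  rises : ∀ {y} → x ≡ suc y → a ≤ y → y < b → ShiftView a b x y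
  fixed-above : x ≤ a → ShiftView a b x x
  fixed-below : b < x → ShiftView a b x x

shift-view : ∀ a b x → ShiftView a b x (shift a b x)
shift-view a b x = view (a <? x) (x ≤? b)
  where
  view : ∀ {x} (a<x? : Dec (a < x)) (x≤b? : Dec (x ≤ b)) → ShiftView a b x (shift-when a<x? x≤b?)
  view {suc x} (yes (s≤s a≤x)) (yes x<b) = rises refl a≤x x<b
  view         (yes _)         (no x≰b)  = fixed-below (≰⇒> x≰b)
  view         (no a≮x)        (yes _)   = fixed-above (≮⇒≥ a≮x)
  view         (no a≮x)        (no _)    = fixed-above (≮⇒≥ a≮x)

shift-≤ : ∀ a b x → shift a b x ≤ x
shift-≤ a b x with shift a b x | shift-view a b x
... | _ | rises refl _ _ = n≤1+n _
... | _ | fixed-above _ = ≤-refl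
... | _ | fixed-below _ = ≤-refl

shift-moves : ∀ {a b x y} → x ≡ suc y → a ≤ y → y < b → shift a b x ≡ y
shift-moves {a} {b} {x} refl a≤y y<b with shift a b x | shift-view a b x
... | _ | rises refl _ _ = refl
... | _ | fixed-above x≤a = contradiction a≤y (<⇒≱ x≤a)
... | _ | fixed-below b<x = contradiction y<b (<⇒≱ b<x)

shift-above : ∀ {a b x} → x ≤ a → shift a b x ≡ x
shift-above {a} {b} {x} x≤a with shift a b x | shift-view a b x
... | _ | rises refl a≤y _ = contradiction a≤y (<⇒≱ x≤a)
... | _ | fixed-above _ = refl
... | _ | fixed-below _ = refl

shift-below : ∀ {a b x} → b < x → shift a b x ≡ x
shift-below {a} {b} {x} b<x with shift a b x | shift-view a b x
... | _ | rises refl _ y<b = contradiction y<b (<⇒≱ b<x)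
... | _ | fixed-above _ = refl
... | _ | fixed-below _ = refl

-- Only `a` and `a + 1` can collide, both being sent to `a`. In the application row `a` is the empty
-- landing row, so no box has position `a`.
shift-mono-< : ∀ a b {x y} → x ≢ a → x < y → shift a b x < shift a b y
shift-mono-< a b {x} {y} x≢a x<y
  with shift a b x | shift-view a b x | shift a b y | shift-view a b y
... | _ | rises refl _ _ | _ | rises refl _ _ = ≤-pred x<y
... | _ | fixed-above x≤a | _ | rises refl a≤z _ = <-≤-trans (≤∧≢⇒< x≤a x≢a) a≤z
... | _ | fixed-below b<x | _ | rises refl _ z<b = contradiction (<-≤-trans x<y z<b) (<-asym b<x)
... | _ | rises refl _ _ | _ | fixed-above _ = <-trans (n<1+n _) x<y
... | _ | rises refl _ _ | _ | fixed-below _ = <-trans (n<1+n _) x<y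
... | _ | fixed-above _ | _ | fixed-above _ = x<y
... | _ | fixed-above _ | _ | fixed-below _ = x<y
... | _ | fixed-below _ | _ | fixed-above _ = x<y
... | _ | fixed-below _ | _ | fixed-below _ = x<y

-- Every move preserves the tracking invariant.

-- A jump over a stack of boxes is tracked as every box of the stack rising by one row.
module Preservation (w : Permutation′ n) (avoids : Avoids1432 w) {i i′ j : Fin n}
                    {E E′ : GraveDiagram n} (S : Slide i i′ j E E′) (T : Tracking w E) where

  open Slide S
  open Tracking T

  a b : ℕ
  a = toℕ i′
  b = toℕ i

  pos′ : Fin n → Fin n → ℕ
  pos′ u c = if does (c ≟ᶠ j) then shift a b (pos u c) else pos u c

  pos′-other : ∀ {u c} → c ≢ j → pos′ u c ≡ pos u c
  pos′-other {c = c} c≢j with c ≟ᶠ j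
  ... | yes c≡j = contradiction c≡j c≢j
  ... | no _    = refl

  pos′-here : ∀ {u} → pos′ u j ≡ shift a b (pos u j)
  pos′-here with j ≟ᶠ j
  ... | yes _  = refl
  ... | no j≢j = contradiction refl j≢j

  pos≢a : ∀ {u} → InRothe w u j → pos u j ≢ a
  pos≢a d eq = target-empty (box⇒occupied E (pos-box d eq))

  pos≢ghost : ∀ {u k g} → InRothe w u k → Ghost E g k → pos u k ≢ toℕ g
  pos≢ghost d g∈ eq = box-not-ghost E (pos-box d eq) g∈

  -- Rows `a + 1` to `b` of column `j` form an unbroken stack. The index `y` is the row after the
  -- shift, as in `rises`.
  between-origin : ∀ {y} → a ≤ y → y < b → ∃[ u ] InRothe w u j × pos u j ≡ suc y
  between-origin {y} a≤y y<b = let u , d , eq = box-origin (boxes-between a<r r≤b) in u , d , trans eq r≡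
    where
    r<n : suc y < n
    r<n = ≤-<-trans y<b (toℕ<n i)
    r≡ : toℕ (fromℕ< r<n) ≡ suc y
    r≡ = toℕ-fromℕ< r<n
    a<r : a < toℕ (fromℕ< r<n)
    a<r = subst (a <_) (sym r≡) (s≤s a≤y)
    r≤b : toℕ (fromℕ< r<n) ≤ b
    r≤b = subst (_≤ b) (sym r≡) y<b

  -- The foot of the stack, whose cell the move vacates; in the tracking it rises by one row only.
  mover : ∃[ p ] InRothe w p j × pos p j ≡ b
  mover = box-origin box

  p : Fin n
  p = proj₁ mover

  p∈ : InRothe w p j
  p∈ = proj₁ (proj₂ mover)

  pos-p : pos p j ≡ b
  pos-p = proj₂ (proj₂ mover)

  pos′-p<b : shift a b (pos p j) < b
  pos′-p<b with shift a b (pos p j) | shift-view a b (pos p j)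
  ... | _ | rises _ _ y<b = y<b
  ... | _ | fixed-above p≤a = ≤-<-trans p≤a upward
  ... | _ | fixed-below b<p = contradiction (sym pos-p) (<⇒≢ b<p)

  past-mover : ∀ {v} → InRothe w v j → toℕ p < toℕ v → b < pos v j
  past-mover {v} d p<v = subst (_< pos v j) pos-p (pos-mono p∈ d p<v)

  pos′-≤ : ∀ {u c} → InRothe w u c → pos′ u c ≤ toℕ u
  pos′-≤ {u} {c} d with c ≟ᶠ j
  ... | yes _ = ≤-trans (shift-≤ a b (pos u c)) (pos-≤ d)
  ... | no _  = pos-≤ d

  pos′-mono : ∀ {u v c} → InRothe w u c → InRothe w v c → toℕ u < toℕ v → pos′ u c < pos′ v c
  pos′-mono {c = c} u∈ v∈ u<v with c ≟ᶠ j
  ... | yes refl = shift-mono-< a b (pos≢a u∈) (pos-mono u∈ v∈ u<v)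
  ... | no _     = pos-mono u∈ v∈ u<v

  landing-origin : ∀ {y} → a ≤ y → y < b → ∃[ u ] InRothe w u j × shift a b (pos u j) ≡ y
  landing-origin a≤y y<b =
    let u , d , eq = between-origin a≤y y<b in u , d , shift-moves eq a≤y y<b

  -- The jump from `b` to `a` and the shift of the stack give the same set of cells: rows `a` to
  -- `b - 1` are filled and row `b` is vacated.
  box-origin′ : ∀ {s k} → Box E′ s k → ∃[ u ] InRothe w u k × pos′ u k ≡ toℕ s
  box-origin′ {s} {k} b∈ with k ≟ᶠ j | box-cases b∈
  ... | yes refl | inj₂ (refl , _) = landing-origin ≤-refl upward
  ... | no _     | inj₁ (b∈E , _)  = box-origin b∈E
  ... | no k≢j   | inj₂ (_ , k≡j)  = contradiction k≡j k≢j
  ... | yes refl | inj₁ (b∈E , s≢i) with a ≤? toℕ s | toℕ s <? b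
  ...   | yes a≤s | yes s<b = landing-origin a≤s s<b
  ...   | no a≰s  | _ =
    let u , d , eq = box-origin b∈E
    in  u , d , trans (shift-above (subst (_≤ a) (sym eq) (<⇒≤ (≰⇒> a≰s)))) eq
  ...   | yes _   | no s≮b =
    let u , d , eq = box-origin b∈E
    in  u , d , trans (shift-below (subst (b <_) (sym eq) (≤∧≢⇒< (≮⇒≥ s≮b)
                        λ b≡s → s≢i (toℕ-injective (sym b≡s) , refl)))) eq

  pos-box′ : ∀ {s u k} → InRothe w u k → pos′ u k ≡ toℕ s → Box E′ s k
  pos-box′ {s} {u} {k} d eq with k ≟ᶠ j
  ... | no k≢j = box-stays (pos-box d eq) (k≢j ∘ proj₂)
  ... | yes refl with shift a b (pos u j) | shift-view a b (pos u j)
  ...   | _ | fixed-above x≤a =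
    box-stays (pos-box d eq) λ { (refl , _) → <⇒≱ upward (subst (_≤ a) eq x≤a) }
  ...   | _ | fixed-below b<x =
    box-stays (pos-box d eq) λ { (refl , _) → <-irrefl refl (subst (b <_) eq b<x) }
  ...   | _ | rises _ a≤y y<b with s ≟ᶠ i′
  ...     | yes refl = box-lands
  ...     | no s≢i′  = box-stays
    (boxes-between (≤∧≢⇒< (subst (a ≤_) eq a≤y) (s≢i′ ∘ sym ∘ toℕ-injective)) (<⇒≤ s<b))
    λ { (refl , _) → <-irrefl refl s<b }
    where
    s<b = subst (_< b) eq y<b

  -- Row `a` is empty and the rows between `a` and `b` hold boxes, so the shift puts no box on an
  -- old ghost.
  ghost-outside : ∀ {g} → Ghost E g j → a ≤ toℕ g → ¬ toℕ g < b
  ghost-outside {g} g∈ a≤g g<b with g ≟ᶠ i′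
  ... | yes refl = target-empty (ghost⇒occupied E g∈)
  ... | no g≢i′  =
    box-not-ghost E (boxes-between (≤∧≢⇒< a≤g (g≢i′ ∘ sym ∘ toℕ-injective)) (<⇒≤ g<b)) g∈

  owns-other⁺ : ∀ {u c g} → c ≢ j → Owns w E pos u c g → Owns w E′ pos′ u c g
  owns-other⁺ c≢j o = record
    { ghost  = ghost-stays (Owns.ghost o)
    ; passed = subst (_< _) (sym (pos′-other c≢j)) (Owns.passed o)
    ; start  = Owns.start o
    ; next   = λ d u<v → subst (_ <_) (sym (pos′-other c≢j)) (Owns.next o d u<v)
    }

  owns-other⁻ : ∀ {u c g} → c ≢ j → Owns w E′ pos′ u c g → Owns w E pos u c g
  owns-other⁻ c≢j o = record
    { ghost  = [ (λ g∈ → g∈) , (λ eq → contradiction (proj₂ eq) c≢j) ]′ (ghost-cases (Owns.ghost o))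
    ; passed = subst (_< _) (pos′-other c≢j) (Owns.passed o)
    ; start  = Owns.start o
    ; next   = λ d u<v → subst (_ <_) (pos′-other c≢j) (Owns.next o d u<v)
    }

  owns-here⁺ : ∀ {u g} → Owns w E pos u j g → Owns w E′ pos′ u j g
  owns-here⁺ {u} {g} o = record
    { ghost  = ghost-stays (Owns.ghost o)
    ; passed = subst (_< _) (sym pos′-here) (≤-<-trans (shift-≤ a b (pos u j)) (Owns.passed o))
    ; start  = Owns.start o
    ; next   = λ d u<v → subst (_ <_) (sym pos′-here) (stays-above (Owns.next o d u<v))
    }
    where
    stays-above : ∀ {x} → toℕ g < x → toℕ g < shift a b x
    stays-above {x} g<x with shift a b x | shift-view a b x
    ... | _ | fixed-above _ = g<x
    ... | _ | fixed-below _ = g<x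
    ... | y | rises refl a≤y y<b = ≤∧≢⇒< (≤-pred g<x) λ { refl →
      ghost-outside (Owns.ghost o) a≤y y<b }

  -- The new ghost is in the row that `p` has just left; boxes that started lower in the column lie
  -- below row `b`, outside the shifted interval.
  owns-new : ∀ {g} → Ghost E′ g j → g ≡ i → Owns w E′ pos′ p j g
  owns-new g∈ refl = record
    { ghost  = g∈
    ; passed = subst (_< b) (sym pos′-here) pos′-p<b
    ; start  = subst (_≤ toℕ p) pos-p (pos-≤ p∈)
    ; next   = λ d p<v → let b<v = past-mover d p<v
                         in subst (b <_) (sym (trans pos′-here (shift-below {a} b<v))) b<v
    }

  owns-here⁻ : ∀ {u g} → InRothe w u j → Owns w E′ pos′ u j g → Owns w E pos u j g ⊎ (g ≡ i × u ≡ p)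
  owns-here⁻ {u} {g} d o with ghost-cases (Owns.ghost o) | subst (_< _) pos′-here (Owns.passed o)
  ... | inj₁ g∈ | passed′ = inj₁ record
    { ghost  = g∈
    ; passed = had-passed passed′
    ; start  = Owns.start o
    ; next   = λ {v} d u<v →
        <-≤-trans (subst (_ <_) pos′-here (Owns.next o d u<v)) (shift-≤ a b (pos v j))
    }
    where
    had-passed : shift a b (pos u j) < toℕ g → pos u j < toℕ g
    had-passed lt with shift a b (pos u j) | shift-view a b (pos u j)
    ... | _ | fixed-above _ = lt
    ... | _ | fixed-below _ = lt
    -- The old row is at most `g`, and it is not `g`, where a ghost sits.
    ... | _ | rises eq _ _ = ≤∧≢⇒< (subst (_≤ _) (sym eq) lt) (pos≢ghost d g∈)
  -- Only `p` can own the ghost in row `b`: a box above `p` violates `next`, because `p` is now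
  -- above row `b`, and a box below `p` has not passed row `b`.
  ... | inj₂ (refl , _) | passed′ with <-cmp (toℕ u) (toℕ p)
  ...   | tri≈ _ u≡p _ = inj₂ (refl , toℕ-injective u≡p)
  ...   | tri< u<p _ _ = contradiction (subst (b <_) pos′-here (Owns.next o p∈ u<p)) (<-asym pos′-p<b)
  ...   | tri> _ _ p<u = contradiction (subst (_< b) (shift-below {a} b<u) passed′) (<-asym b<u)
    where b<u = past-mover d p<u

  ghost-owner′ : ∀ {g k} → Ghost E′ g k → ∃[ u ] InRothe w u k × Owns w E′ pos′ u k g
  ghost-owner′ {g} {k} g∈ = by-column (k ≟ᶠ j) (ghost-cases g∈)
    where
    by-column : Dec (k ≡ j) → Ghost E g k ⊎ (g ≡ i × k ≡ j) → ∃[ u ] InRothe w u k × Owns w E′ pos′ u k g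
    by-column (no k≢j)   (inj₁ g∈E) = let u , d , o = ghost-owner g∈E in u , d , owns-other⁺ k≢j o
    by-column (yes refl) (inj₁ g∈E) = let u , d , o = ghost-owner g∈E in u , d , owns-here⁺ o
    by-column _ (inj₂ (refl , refl)) = p , p∈ , owns-new g∈ refl

  module _ {k : Fin n} (j<k : toℕ j < toℕ k) where

    -- Downward induction along the stack: avoidance puts column k under the whole stack,
    -- where each of its boxes is strictly above the corresponding box of column j.
    stack-clear : ∀ t {v y} → t + suc y ≡ b → a ≤ y → y < b → pos v j ≡ suc y →
                  InRothe w v j → InRothe w v k →
                  pos v k ≤ y × (∀ g → Owns w E pos v k g → toℕ g ≤ y)
    stack-clear zero {v} {y} sy≡b a≤y y<b eq vj vk =
      -- This box is the mover in row `b`. It is rightmost there, so column `k` has neither box nor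
      -- ghost in row `b`, and the weak bounds become strict.
      let le , gh = weakly-above (staircase j<k vj vk) in
        strictly-above le (λ at-b → right-empty j<k (box⇒occupied E (pos-box vk at-b)))
      , λ g o → strictly-above (gh g o) λ g≡b →
          right-empty j<k (subst (λ r → Occupied E r k) (toℕ-injective g≡b)
                                 (ghost⇒occupied E (Owns.ghost o)))
      where
      WeaklyAbove : ℕ → Set
      WeaklyAbove x = pos v k ≤ x × (∀ g → Owns w E pos v k g → toℕ g ≤ x)
      pos≡b : pos v j ≡ b
      pos≡b = trans eq sy≡b
      strictly-above : ∀ {x} → x ≤ b → x ≢ b → x ≤ y
      strictly-above x≤b x≢b = ≤-pred (subst (_ <_) (sym sy≡b) (≤∧≢⇒< x≤b x≢b))
      weakly-above : pos v j ≡ toℕ v ⊎ WeaklyAbove (pos v j) → WeaklyAbove b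
      weakly-above (inj₁ pos≡v) = subst WeaklyAbove (trans (sym pos≡v) pos≡b) (pos-≤ vk , λ _ → Owns.start)
      weakly-above (inj₂ wa) = subst WeaklyAbove pos≡b wa
    stack-clear (suc t) {v} {y} eqb a≤y y<b eq vj vk =
      below-next (complete-or-full w avoids vj vk v′j v<v′ j<k)
      where
      sy<b : suc y < b
      sy<b = subst (suc y <_) eqb (s≤s (m≤n+m (suc y) t))
      next-box = between-origin (≤-trans a≤y (n≤1+n y)) sy<b
      v′   = proj₁ next-box
      v′j  = proj₁ (proj₂ next-box)
      eq′  = proj₂ (proj₂ next-box)
      v<v′ : toℕ v < toℕ v′
      v<v′ = pos-reflects-< vj v′j (subst₂ _<_ (sym eq) (sym eq′) (n<1+n (suc y)))
      below-next : InRothe w v′ k ⊎ (∀ s → toℕ s ≤ toℕ v → InRothe w s j) →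
                   pos v k ≤ y × (∀ g → Owns w E pos v k g → toℕ g ≤ y)
      below-next (inj₁ v′k) =
        let le , _ = stack-clear t (trans (+-suc t (suc y)) eqb) (≤-trans a≤y (n≤1+n y)) sy<b eq′ v′j v′k
        in  ≤-pred (<-≤-trans (pos-mono vk v′k v<v′) le)
          , λ g o → ≤-pred (<-≤-trans (Owns.next o v′k v<v′) le)
      -- A column filled down to row `v` would keep the box that started at `(i′ , j)` in row `a`,
      -- which is empty.
      below-next (inj₂ full) = contradiction
        (≤-antisym (pos-≤ (full i′ a≤v)) (pos-full λ s s≤i′ → full s (≤-trans s≤i′ a≤v)))
        (pos≢a (full i′ a≤v))
        where
        a≤v : a ≤ toℕ v
        a≤v = ≤-trans a≤y (≤-trans (n≤1+n y) (subst (_≤ toℕ v) eq (pos-≤ vj)))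

  staircase′ : ∀ {u c k} → toℕ c < toℕ k → InRothe w u c → InRothe w u k →
               pos′ u c ≡ toℕ u ⊎ (pos′ u k ≤ pos′ u c × (∀ g → Owns w E′ pos′ u k g → toℕ g ≤ pos′ u c))
  staircase′ {u} {c} {k} c<k uc uk = by-columns (c ≟ᶠ j) (k ≟ᶠ j)
    where
    Staircase : ℕ → Set
    Staircase x = x ≡ toℕ u ⊎ (pos′ u k ≤ x × (∀ g → Owns w E′ pos′ u k g → toℕ g ≤ x))
    right-fixed : ∀ {x} → k ≢ j → pos u k ≤ x × (∀ g → Owns w E pos u k g → toℕ g ≤ x) →
                  pos′ u k ≤ x × (∀ g → Owns w E′ pos′ u k g → toℕ g ≤ x)
    right-fixed k≢j (le , gh) = subst (_≤ _) (sym (pos′-other k≢j)) le , λ g → gh g ∘ owns-other⁻ k≢j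
    unmoved : k ≢ j → Staircase (pos u c)
    unmoved k≢j = [ inj₁ , inj₂ ∘ right-fixed k≢j ]′ (staircase c<k uc uk)
    by-columns : Dec (c ≡ j) → Dec (k ≡ j) → Staircase (pos′ u c)
    by-columns (yes refl) (yes refl) = contradiction c<k (<-irrefl refl)
    by-columns (no c≢j)   (no k≢j)   = subst Staircase (sym (pos′-other c≢j)) (unmoved k≢j)
    by-columns (no c≢j)   (yes refl) = subst Staircase (sym (pos′-other c≢j)) (right-moves (staircase c<k uc uk))
      where
      right-moves : pos u c ≡ toℕ u ⊎ (pos u j ≤ pos u c × (∀ g → Owns w E pos u j g → toℕ g ≤ pos u c)) →
                    Staircase (pos u c)
      right-moves (inj₁ eq)        = inj₁ eq
      right-moves (inj₂ (le , gh)) = inj₂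
        ( subst (_≤ _) (sym pos′-here) (≤-trans (shift-≤ a b (pos u j)) le)
        -- The new ghost is in the old row of `p`, so the old bound on the position of `p` covers
        -- it.
        , λ g o → [ gh g , (λ { (refl , refl) → subst (_≤ pos u c) pos-p le }) ]′ (owns-here⁻ uk o))
    by-columns (yes refl) (no k≢j) = subst Staircase (sym pos′-here) left-moves
      where
      left-moves : Staircase (shift a b (pos u j))
      left-moves with shift a b (pos u j) | shift-view a b (pos u j)
      ... | _ | fixed-above _ = unmoved k≢j
      ... | _ | fixed-below _ = unmoved k≢j
      ... | y | rises eq a≤y y<b =
        inj₂ (right-fixed k≢j (stack-clear c<k (b ∸ suc y) (m∸n+n≡m y<b) a≤y y<b eq uc uk))

  tracking′ : Tracking w E′
  tracking′ = record
    { pos         = pos′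
    ; pos-≤       = pos′-≤
    ; pos-mono    = pos′-mono
    ; box-origin  = box-origin′
    ; pos-box     = pos-box′
    ; ghost-owner = ghost-owner′
    ; staircase   = staircase′
    }

module _ (w : Permutation′ n) (avoids : Avoids1432 w) where

  tracked : ∀ {E E′} → Tracking w E → Star AnyMove E E′ → Tracking w E′
  tracked T ε = T
  tracked T ((_ , _ , move) ◅ path) = tracked (Preservation.tracking′ w avoids (proj₂ (slide move)) T) path

-- Undoing one simple move.

-- The hypotheses single out (i , j) as the last moved box in the order of processing; it is sent
-- back down by one row.
module Undo (w : Permutation′ n) (avoids : Avoids1432 w) {E : GraveDiagram n} (T : Tracking w E)
            {i j : Fin n} (i,j∈ : InRothe w i j) (moved : Tracking.pos T i j < toℕ i)
            (settled-below : ∀ {u c} → toℕ i < toℕ u → InRothe w u c → Tracking.pos T u c ≡ toℕ u)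
            (settled-left : ∀ {c} → toℕ c < toℕ j → InRothe w i c → Tracking.pos T i c ≡ toℕ i)
  where

  open Tracking T

  i₁<n : suc (pos i j) < n
  i₁<n = ≤-<-trans moved (toℕ<n i)

  -- `e` is the current row of the tracked box and `i₁` the row below it, to which it is sent back.
  e i₁ : Fin n
  e  = fromℕ< (<-trans (n<1+n _) i₁<n)
  i₁ = fromℕ< i₁<n

  e≡ : toℕ e ≡ pos i j
  e≡ = toℕ-fromℕ< _

  i₁≡ : toℕ i₁ ≡ suc (pos i j)
  i₁≡ = toℕ-fromℕ< i₁<n

  i₁≡1+e : toℕ i₁ ≡ suc (toℕ e)
  i₁≡1+e = trans i₁≡ (cong suc (sym e≡))

  e<i₁ : toℕ e < toℕ i₁
  e<i₁ = ≤-reflexive (sym i₁≡1+e)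

  i₁≤i : toℕ i₁ ≤ toℕ i
  i₁≤i = subst (_≤ toℕ i) (sym i₁≡) moved

  box-e : Box E e j
  box-e = pos-box i,j∈ (sym e≡)

  -- Such a box would have started below row `i`, hence be settled there, but `i₁` is at most `i`.
  no-box-i₁ : ¬ Box E i₁ j
  no-box-i₁ b∈ with box-origin b∈
  ... | u , u,j∈ , eq = <⇒≱ i<u u≤i
    where
    i<u : toℕ i < toℕ u
    i<u = pos-reflects-< i,j∈ u,j∈ (≤-reflexive (sym (trans eq i₁≡)))
    u≤i : toℕ u ≤ toℕ i
    u≤i = subst (_≤ toℕ i) (trans (sym eq) (settled-below i<u u,j∈)) i₁≤i

  -- A ghost at `(i₁ , j)` is deleted as well. If there was one, the move being undone is a K-move;
  -- otherwise it is ordinary.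
  E° : GraveDiagram n
  E° = grave ((boxes E - cell e j) ∪ ⁅ cell i₁ j ⁆) (ghosts E - cell i₁ j) λ c b∈ g∈ →
    [ (λ (c∈ , _) → box-not-ghost E c∈ (p─q⊆p _ _ g∈))
    , (λ { refl → x∉p-x (ghosts E) c g∈ })
    ]′ (∈-replace⁻ (boxes E) (cell e j) (cell i₁ j) b∈)

  box°-cases : ∀ {s k} → Box E° s k → (Box E s k × ¬ (s ≡ e × k ≡ j)) ⊎ (s ≡ i₁ × k ≡ j)
  box°-cases = ∈-replace-cell⁻ (boxes E)

  box°-stays : ∀ {s k} → Box E s k → ¬ (s ≡ e × k ≡ j) → Box E° s k
  box°-stays = ∈-replace-cell⁺

  box°-i₁ : Box E° i₁ j
  box°-i₁ = ∈-insertʳ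

  ghost°-cases : ∀ {g k} → Ghost E° g k → Ghost E g k × ¬ (g ≡ i₁ × k ≡ j)
  ghost°-cases g∈ = let g∈E , ≢ = x∈p-y⁻ (ghosts E) (cell i₁ j) g∈ in g∈E , λ { (refl , refl) → ≢ refl }

  ghost°-stays : ∀ {g k} → Ghost E g k → ¬ (g ≡ i₁ × k ≡ j) → Ghost E° g k
  ghost°-stays g∈ ≢ = x∈p∧x≢y⇒x∈p-y g∈ (≢ ∘ cell-injective)

  pos° : Fin n → Fin n → ℕ
  pos° u c = if does (u ≟ᶠ i) ∧ does (c ≟ᶠ j) then suc (pos i j) else pos u c

  data View (u c : Fin n) : ℕ → Set where
    here  : u ≡ i → c ≡ j → View u c (suc (pos i j))
    other : ¬ (u ≡ i × c ≡ j) → View u c (pos u c)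

  view : ∀ u c → View u c (pos° u c)
  view u c with u ≟ᶠ i | c ≟ᶠ j
  ... | yes u≡i | yes c≡j = here u≡i c≡j
  ... | yes _   | no c≢j  = other (c≢j ∘ proj₂)
  ... | no u≢i  | _       = other (u≢i ∘ proj₁)

  pos°-here : pos° i j ≡ suc (pos i j)
  pos°-here with pos° i j | view i j
  ... | _ | here _ _ = refl
  ... | _ | other ≢  = contradiction (refl , refl) ≢

  pos°-other : ∀ {u c} → ¬ (u ≡ i × c ≡ j) → pos° u c ≡ pos u c
  pos°-other {u} {c} ≢ with pos° u c | view u c
  ... | _ | here u≡i c≡j = contradiction (u≡i , c≡j) ≢
  ... | _ | other _      = refl

  pos-≤-pos° : ∀ u c → pos u c ≤ pos° u c
  pos-≤-pos° u c with pos° u c | view u c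
  ... | _ | here refl refl = n≤1+n _
  ... | _ | other _        = ≤-refl

  pos°-≤ : ∀ {u c} → InRothe w u c → pos° u c ≤ toℕ u
  pos°-≤ {u} {c} u,c∈ with pos° u c | view u c
  ... | _ | here refl refl = moved
  ... | _ | other _        = pos-≤ u,c∈

  pos°-mono : ∀ {u v c} → InRothe w u c → InRothe w v c → toℕ u < toℕ v → pos° u c < pos° v c
  pos°-mono {u} {v} {c} u∈ v∈ u<v with pos° u c | view u c | pos° v c | view v c
  ... | _ | here refl refl | _ | here refl _    = contradiction u<v (<-irrefl refl)
  ... | _ | here refl refl | _ | other _        =
    subst (_ <_) (sym (settled-below u<v v∈)) (≤-<-trans moved u<v)
  ... | _ | other _        | _ | here refl refl = <-trans (pos-mono u∈ v∈ u<v) (n<1+n _)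
  ... | _ | other _        | _ | other _        = pos-mono u∈ v∈ u<v

  box-origin° : ∀ {s k} → Box E° s k → ∃[ u ] InRothe w u k × pos° u k ≡ toℕ s
  box-origin° b∈ with box°-cases b∈
  ... | inj₂ (refl , refl) = i , i,j∈ , trans pos°-here (sym i₁≡)
  ... | inj₁ (b∈E , ≢) with box-origin b∈E
  ...   | u , u,k∈ , eq = u , u,k∈ , trans (pos°-other λ { (refl , refl) →
    ≢ (toℕ-injective (trans (sym eq) (sym e≡)) , refl) }) eq

  pos-box° : ∀ {s u k} → InRothe w u k → pos° u k ≡ toℕ s → Box E° s k
  pos-box° {s} {u} {k} u,k∈ eq with pos° u k | view u k
  ... | _ | here refl refl = subst (λ r → Box E° r j) (toℕ-injective (trans i₁≡ eq)) box°-i₁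
  ... | _ | other ≢ = box°-stays (pos-box u,k∈ eq) λ { (refl , refl) →
    ≢ (pos-injective u,k∈ i,j∈ (trans eq e≡) , refl) }

  owns°⁺ : ∀ {u k g} → ¬ (g ≡ i₁ × k ≡ j) → Owns w E pos u k g → Owns w E° pos° u k g
  owns°⁺ {u} {k} {g} g≢i₁ o = record
    { ghost  = ghost°-stays (Owns.ghost o) g≢i₁
    ; passed = passed°
    ; start  = Owns.start o
    ; next   = λ {v} v,k∈ u<v → <-≤-trans (Owns.next o v,k∈ u<v) (pos-≤-pos° v k)
    }
    where
    passed° : pos° u k < toℕ g
    passed° with pos° u k | view u k
    ... | _ | other _        = Owns.passed o
    -- The lowered box enters row `i₁`, whose ghost in this column, if any, has been deleted.
    ... | _ | here refl refl =
      ≤∧≢⇒< (Owns.passed o) λ eq → g≢i₁ (toℕ-injective (trans (sym eq) (sym i₁≡)) , refl)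

  owns°⁻ : ∀ {u k g} → Owns w E° pos° u k g → Owns w E pos u k g
  owns°⁻ {u} {k} {g} o = record
    { ghost  = g∈
    ; passed = ≤-<-trans (pos-≤-pos° u k) (Owns.passed o)
    ; start  = Owns.start o
    ; next   = λ v,k∈ u<v → next⁻ (Owns.next o v,k∈ u<v)
    }
    where
    g∈ = proj₁ (ghost°-cases (Owns.ghost o))
    next⁻ : ∀ {v} → toℕ g < pos° v k → toℕ g < pos v k
    next⁻ {v} lt with pos° v k | view v k
    ... | _ | other _        = lt
    ... | _ | here refl refl = ≤∧≢⇒< (≤-pred lt) λ eq →
      box-not-ghost E (pos-box i,j∈ (sym eq)) g∈

  ghost-owner° : ∀ {g k} → Ghost E° g k → ∃[ u ] InRothe w u k × Owns w E° pos° u k g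
  ghost-owner° g∈ =
    let g∈E , g≢i₁ = ghost°-cases g∈
        u , u,k∈ , o = ghost-owner g∈E
    in  u , u,k∈ , owns°⁺ g≢i₁ o

  staircase° : ∀ {u c k} → toℕ c < toℕ k → InRothe w u c → InRothe w u k →
               pos° u c ≡ toℕ u ⊎ (pos° u k ≤ pos° u c × (∀ g → Owns w E° pos° u k g → toℕ g ≤ pos° u c))
  staircase° {u} {c} {k} c<k u,c∈ u,k∈ with pos° u c | view u c | pos° u k | view u k | owns°⁻ {u} {k}
  ... | _ | here refl refl | _ | here _ refl    | _ = contradiction c<k (<-irrefl refl)
  -- Lowering the right box is harmless, since `settled-left` keeps the left one at its start.
  ... | _ | other _        | _ | here refl refl | _ = inj₁ (settled-left c<k u,c∈)
  ... | _ | other _        | _ | other _        | owns⁻ =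
    [ inj₁ , (λ (le , gh) → inj₂ (le , λ g → gh g ∘ owns⁻)) ]′ (staircase c<k u,c∈ u,k∈)
  -- Lowering the left box only weakens the bound on the right one.
  ... | _ | here refl refl | _ | other _        | owns⁻ =
    [ (λ eq → contradiction eq (<⇒≢ moved))
    , (λ (le , gh) → inj₂ (≤-trans le (n≤1+n _) , λ g o → ≤-trans (gh g (owns⁻ o)) (n≤1+n _)))
    ]′ (staircase c<k u,c∈ u,k∈)

  tracking° : Tracking w E°
  tracking° = record
    { pos         = pos°
    ; pos-≤       = pos°-≤
    ; pos-mono    = pos°-mono
    ; box-origin  = box-origin°
    ; pos-box     = pos-box°
    ; ghost-owner = ghost-owner°
    ; staircase   = staircase°
    }

  module _ {k : Fin n} (j<k : toℕ j < toℕ k) where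

    right-of-mover : InRothe w i k → pos i k ≤ pos i j × (∀ g → Owns w E pos i k g → toℕ g ≤ pos i j)
    right-of-mover i,k∈ = [ (λ eq → contradiction eq (<⇒≢ moved)) , (λ above → above) ]′ (staircase j<k i,j∈ i,k∈)

    occupant : Occupied E i₁ k → ∃[ u ] InRothe w u k × (pos u k ≡ toℕ i₁ ⊎ Owns w E pos u k i₁)
    occupant occ with occupied⇒ E occ
    ... | inj₁ b∈ = let u , u,k∈ , eq = box-origin b∈ in u , u,k∈ , inj₁ eq
    ... | inj₂ g∈ = let u , u,k∈ , o = ghost-owner g∈ in u , u,k∈ , inj₂ o

    -- By starting row `u`. Below row `i` boxes are settled. In row `i` the staircase gives the
    -- bound `pos i j`. Above row `i`, avoidance leaves two cases. If `(i , k)` starts as a box, it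
    -- is bounded by `pos i j` and lies below everything stemming from `(u , k)`. If column `j` is
    -- full down to `u`, then `u ≤ pos u j < pos i j`, while nothing from `(u , k)` is below row
    -- `u`.
    no-occupant : ∀ {u} → InRothe w u k → ¬ (pos u k ≡ toℕ i₁ ⊎ Owns w E pos u k i₁)
    no-occupant {u} u,k∈ occ with <-cmp (toℕ u) (toℕ i)
    ... | tri> _ _ i<u = <⇒≱ (≤-<-trans i₁≤i i<u) (subst (_≤ toℕ i₁) (settled-below i<u u,k∈)
      ([ ≤-reflexive , <⇒≤ ∘ Owns.passed ]′ occ))
    ... | tri≈ _ u≡i _ rewrite toℕ-injective u≡i =
      let le , gh = right-of-mover u,k∈ in
      <⇒≱ (≤-reflexive (sym i₁≡)) ([ (λ eq → subst (_≤ pos i j) eq le) , gh i₁ ]′ occ)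
    ... | tri< u<i _ _ with rothe-left w u,k∈ i,j∈ u<i j<k
    ...   | u,j∈ with complete-or-full w avoids u,j∈ u,k∈ i,j∈ u<i j<k
    ...     | inj₁ i,k∈ = <⇒≱ (≤-reflexive (sym i₁≡)) (≤-trans
      (<⇒≤ ([ (λ eq → subst (_< pos i k) eq (pos-mono u,k∈ i,k∈ u<i)) , (λ o → Owns.next o i,k∈ u<i) ]′ occ))
      (proj₁ (right-of-mover i,k∈)))
    ...     | inj₂ full = <⇒≱ (<-trans (≤-<-trans (pos-full full) (pos-mono u,j∈ i,j∈ u<i)) (≤-reflexive (sym i₁≡)))
      ([ (λ eq → subst (_≤ toℕ u) eq (pos-≤ u,k∈)) , Owns.start ]′ occ)

    right-clear : ¬ Occupied E i₁ k
    right-clear occ = let _ , u,k∈ , at = occupant occ in no-occupant u,k∈ at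

  movable° : Movable E° i₁ j e
  movable° = record
    { box        = box°-i₁
    ; rightmost  = box⇒occupied E° box°-i₁ , λ k occ → ≮⇒≥ λ j<k → right-clear j<k
        ([ (λ b∈ → [ box⇒occupied E ∘ proj₁ , (λ { (_ , refl) → contradiction j<k (<-irrefl refl) }) ]′
                   (box°-cases b∈))
         , ghost⇒occupied E ∘ proj₁ ∘ ghost°-cases ]′ (occupied⇒ E° occ))
    ; target     = (e<i₁ , λ occ → [ (λ b∈ → [ (λ (_ , ≢) → ≢ (refl , refl))
                                             , (λ (e≡i₁ , _) → <-irrefl (cong toℕ e≡i₁) e<i₁) ]′ (box°-cases b∈))
                                   , box-not-ghost E box-e ∘ proj₁ ∘ ghost°-cases ]′ (occupied⇒ E° occ))
                 , λ r (r<i₁ , _) → ≤-pred (subst (toℕ r <_) i₁≡1+e r<i₁)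
    ; boxes-only = λ r e<r r≤i₁ _ → subst (λ s → Box E° s j)
        (toℕ-injective (≤-antisym (subst (_≤ toℕ r) (sym i₁≡1+e) e<r) r≤i₁)) box°-i₁
    }

  move° : Move i₁ e E° E
  move° with cell i₁ j ∈? ghosts E
  ... | no g∉  = ordinary movable° (sym (replace-replace box-e no-box-i₁)) (sym (p-y-absent g∉))
  ... | yes g∈ = K-move movable° (sym (replace-replace box-e no-box-i₁)) (sym (remove-insert g∈))

  simple-move° : SimpleMove E° E
  simple-move° = i₁ , e , move° , i₁≡1+e

-- Tracked diagrams are reachable by simple moves.

module Reachability (w : Permutation′ n) (avoids : Avoids1432 w) where

  open Tracking

  Settled : ∀ {E} → Tracking w E → Fin n → Fin n → Set
  Settled T u c = InRothe w u c → pos T u c ≡ toℕ u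

  settled⇒initial : ∀ {E} (T : Tracking w E) → (∀ u c → Settled T u c) → E ≡ initial w
  settled⇒initial {E} T settled = grave-≡ (cells-≡ box⇒ ⇒box) (cells-≡ ghost⇒ λ _ _ c∈ → contradiction c∈ ∉⊥)
    where
    box⇒ : ∀ s k → Box E s k → cell s k ∈ rothe w
    box⇒ s k b∈ with box-origin T b∈
    ... | u , u,k∈ , eq = Equivalence.from (∈-rothe w s k)
      (subst (λ r → InRothe w r k) (toℕ-injective (trans (sym (settled u k u,k∈)) eq)) u,k∈)
    ⇒box : ∀ s k → cell s k ∈ rothe w → Box E s k
    ⇒box s k c∈ = let s,k∈ = Equivalence.to (∈-rothe w s k) c∈ in pos-box T s,k∈ (settled s k s,k∈)
    ghost⇒ : ∀ g k → Ghost E g k → cell g k ∈ ∅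
    ghost⇒ g k g∈ with ghost-owner T g∈
    -- A ghost lies strictly below its owner and weakly above the owner's start, so a settled box
    -- owns none.
    ... | u , u,k∈ , o = contradiction (Owns.start o) (<⇒≱ (subst (_< toℕ g) (settled u k u,k∈) (Owns.passed o)))

  mutual

    -- The recursion undoes moves, so it runs opposite to the climbing order: rows from bottom to
    -- top, left to right in a row. `I` counts the rows still to be treated, `m` in `columns` the
    -- columns, and `t` in `steps` bounds the remaining descent of one box.
    rows : ∀ I → I ≤ n → ∀ {E} (T : Tracking w E) →
           (∀ {u c} → I ≤ toℕ u → Settled T u c) → SKKoh w E
    rows zero    _   T settled = subst (SKKoh w) (sym (settled⇒initial T λ _ _ → settled z≤n)) ε
    rows (suc I) I<n T settled =
      columns I (fromℕ< I<n) (toℕ-fromℕ< I<n) n 0 (+-identityʳ n) T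
        (λ i<u → settled (subst (_< _) (toℕ-fromℕ< I<n) i<u)) (λ ())

    columns : ∀ I i → toℕ i ≡ I → ∀ m c₀ → m + c₀ ≡ n → ∀ {E} (T : Tracking w E) →
              (∀ {u c} → toℕ i < toℕ u → Settled T u c) →
              (∀ {c} → toℕ c < c₀ → Settled T i c) → SKKoh w E
    columns I i i≡I zero c₀ refl T below left = rows I (subst (_≤ n) i≡I (toℕ≤n i)) T row-settled
      where
      row-settled : ∀ {u c} → I ≤ toℕ u → Settled T u c
      row-settled {u} {c} I≤u with m≤n⇒m<n∨m≡n I≤u
      ... | inj₁ I<u = below (subst (_< toℕ u) (sym i≡I) I<u)
      ... | inj₂ I≡u = subst (λ r → Settled T r c) (toℕ-injective (trans i≡I I≡u)) (left (toℕ<n c))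
    columns I i i≡I (suc m) c₀ eq T below left =
      steps I i i≡I m j (trans (+-suc m _) (trans (cong (λ c → suc (m + c)) j≡c₀) eq))
        (toℕ i ∸ pos T i j) T (m≤n+m∸n (toℕ i) (pos T i j)) below
        (λ {c} c<j → left (subst (toℕ c <_) j≡c₀ c<j))
      where
      c₀<n : c₀ < n
      c₀<n = ≤-trans (s≤s (m≤n+m c₀ m)) (≤-reflexive eq)
      j = fromℕ< c₀<n
      j≡c₀ : toℕ j ≡ c₀
      j≡c₀ = toℕ-fromℕ< c₀<n

    steps : ∀ I i → toℕ i ≡ I → ∀ m j → m + suc (toℕ j) ≡ n → ∀ t {E} (T : Tracking w E) →
            toℕ i ≤ pos T i j + t →
            (∀ {u c} → toℕ i < toℕ u → Settled T u c) →
            (∀ {c} → toℕ c < toℕ j → Settled T i c) → SKKoh w E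
    steps I i i≡I m j eq t T i≤ below left with inRothe? w i j | pos T i j <? toℕ i
    ... | no i,j∉ | _ = columns I i i≡I m (suc (toℕ j)) eq T below left′
      where
      left′ : ∀ {c} → toℕ c < suc (toℕ j) → Settled T i c
      left′ c≤j with m≤n⇒m<n∨m≡n (≤-pred c≤j)
      ... | inj₁ c<j = left c<j
      ... | inj₂ c≡j = λ i,c∈ → contradiction (subst (InRothe w i) (toℕ-injective c≡j) i,c∈) i,j∉
    ... | yes i,j∈ | no pos≮i = columns I i i≡I m (suc (toℕ j)) eq T below left′
      where
      left′ : ∀ {c} → toℕ c < suc (toℕ j) → Settled T i c
      left′ c≤j with m≤n⇒m<n∨m≡n (≤-pred c≤j)
      ... | inj₁ c<j = left c<j
      ... | inj₂ c≡j = subst (Settled T i) (sym (toℕ-injective c≡j)) λ _ → ≤-antisym (pos-≤ T i,j∈) (≮⇒≥ pos≮i)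
    steps I i i≡I m j eq zero T i≤ below left | yes _ | yes moved = contradiction (subst (toℕ i ≤_) (+-identityʳ _) i≤) (<⇒≱ moved)
    steps I i i≡I m j eq (suc t) T i≤ below left | yes i,j∈ | yes moved =
      -- The recursion reaches `E°` with one unit less of `t`; the undone move is then appended at
      -- the end of the path.
      steps I i i≡I m j eq t tracking°
        (subst (toℕ i ≤_) (trans (+-suc _ t) (cong (_+ t) (sym pos°-here))) i≤)
        (λ i<u u,c∈ → trans (pos°-other λ { (refl , _) → <-irrefl refl i<u }) (below i<u u,c∈))
        (λ c<j i,c∈ → trans (pos°-other λ { (_ , refl) → <-irrefl refl c<j }) (left c<j i,c∈))
      ◅◅ simple-move° ◅ ε
      where open Undo w avoids T i,j∈ moved below left

  tracking⇒SKKoh : ∀ {E} → Tracking w E → SKKoh w E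
  tracking⇒SKKoh T = rows n ≤-refl T λ {u} n≤u → contradiction n≤u (<⇒≱ (toℕ<n u))

SKKoh⊆KKoh : ∀ (w : Permutation′ n) {E} → SKKoh w E → KKoh w E
SKKoh⊆KKoh w = Star.map λ (i , i′ , move , _) → i , i′ , move

KKoh⊆SKKoh : ∀ (w : Permutation′ n) → Avoids1432 w → ∀ {E} → KKoh w E → SKKoh w E
KKoh⊆SKKoh w avoids path =
  Reachability.tracking⇒SKKoh w avoids (tracked w avoids (initial-tracking w) path)

-- Jumping above row `j₂` in the presence of a 1432 pattern.

exists-max : ∀ {P : Pred (Fin n) 0ℓ} → Decidable P → ∃[ r ] P r → ∃[ m ] IsMax P m
exists-max {suc n} {P} P? (r , Pr) with any? (P? ∘ suc)
... | yes some = let m , Pm , max = exists-max (P? ∘ suc) some in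
  suc m , Pm , λ { zero _ → z≤n ; (suc s) Ps → s≤s (max s Ps) }
... | no none = zero , zero-holds r Pr , λ { zero _ → z≤n ; (suc s) Ps → contradiction (s , Ps) none }
  where
  zero-holds : ∀ r → P r → P zero
  zero-holds zero    P0 = P0
  zero-holds (suc s) Ps = contradiction (s , Ps) none

ordinary-result : ∀ {E : GraveDiagram n} {i j i′} → Movable E i j i′ →
                  Σ[ E′ ∈ GraveDiagram n ] Move i i′ E E′ × Slide i i′ j E E′ × ghosts E′ ≡ ghosts E
ordinary-result {E = E} {i} {j} {i′} mv = E′ , move , proj₂ (slide move) , refl
  where
  E′ = grave ((boxes E - cell i j) ∪ ⁅ cell i′ j ⁆) (ghosts E) λ c b∈ g∈ →
    [ (λ (c∈ , _) → box-not-ghost E c∈ g∈)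
    , (λ { refl → proj₂ (proj₁ (Movable.target mv)) (ghost⇒occupied E g∈) })
    ]′ (∈-replace⁻ (boxes E) (cell i j) (cell i′ j) b∈)
  move : Move i i′ E E′
  move = ordinary mv refl refl

module Jump (w : Permutation′ n) {j₁ j₂ j₃ j₄ : Fin n}
            (j₁<j₂ : toℕ j₁ < toℕ j₂) (j₂<j₃ : toℕ j₂ < toℕ j₃) (j₃<j₄ : toℕ j₃ < toℕ j₄)
            (w₁<w₄ : toℕ (w ⟨$⟩ʳ j₁) < toℕ (w ⟨$⟩ʳ j₄)) (w₄<w₃ : toℕ (w ⟨$⟩ʳ j₄) < toℕ (w ⟨$⟩ʳ j₃))
            (w₃<w₂ : toℕ (w ⟨$⟩ʳ j₃) < toℕ (w ⟨$⟩ʳ j₂)) where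

  rightmost-in-row₃ : ∃[ k ] IsMax (InRothe w j₃) k
  -- Row `j₃` is nonempty because the last two entries of the pattern put `(j₃ , w j₄)` into it.
  rightmost-in-row₃ = exists-max (inRothe? w j₃)
    (w ⟨$⟩ʳ j₄ , subst (λ r → toℕ j₃ < toℕ r) (sym (inverseˡ w)) j₃<j₄ , w₄<w₃)

  a b : Fin n
  a = proj₁ rightmost-in-row₃
  b = w ⟨$⟩ʳ j₃

  j₃,a∈ : InRothe w j₃ a
  j₃,a∈ = proj₁ (proj₂ rightmost-in-row₃)

  a-max : ∀ k → InRothe w j₃ k → toℕ k ≤ toℕ a
  a-max = proj₂ (proj₂ rightmost-in-row₃)

  a<b : toℕ a < toℕ b
  a<b = proj₂ j₃,a∈

  a≢b : a ≢ b
  a≢b a≡b = <-irrefl (cong toℕ a≡b) a<b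

  j₂,a∈ : InRothe w j₂ a
  j₂,a∈ = <-trans j₂<j₃ (proj₁ j₃,a∈) , <-trans a<b w₃<w₂

  j₂,b∈ : InRothe w j₂ b
  j₂,b∈ = subst (λ r → toℕ j₂ < toℕ r) (sym (inverseˡ w)) j₂<j₃ , w₃<w₂

  -- Maximality of `a` gives `w j₁ < w j₄ ≤ a`. This gap in column `a` is what leaves room for the
  -- climb.
  j₁,a∉ : ¬ InRothe w j₁ a
  j₁,a∉ (_ , a<w₁) = <⇒≱ (<-trans a<w₁ w₁<w₄)
    (a-max _ (subst (λ r → toℕ j₃ < toℕ r) (sym (inverseˡ w)) j₃<j₄ , w₄<w₃))

  -- The rows above `r` are still initial, so the gaps of column `a` there can be read off `w`;
  -- `last` makes the climber movable.
  record Climbing (r : Fin n) (E : GraveDiagram n) : Set where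
    field
      reachable : KKoh w E
      ghostless : ∀ {s k} → ¬ Ghost E s k
      above⇒    : ∀ {s k} → toℕ s < toℕ r → Box E s k → InRothe w s k
      ⇒above    : ∀ {s k} → toℕ s < toℕ r → InRothe w s k → Box E s k
      climber   : Box E r a
      last      : ∀ {k} → Box E r k → toℕ k ≤ toℕ a
      b⇒        : ∀ {s} → Box E s b → InRothe w s b

  rothe⇒ : ∀ {s k} → Box (initial w) s k → InRothe w s k
  rothe⇒ = Equivalence.to (∈-rothe w _ _)

  ⇒rothe : ∀ {s k} → InRothe w s k → Box (initial w) s k
  ⇒rothe = Equivalence.from (∈-rothe w _ _)

  climbing-start : Climbing j₃ (initial w)
  climbing-start = record
    { reachable = ε
    ; ghostless = ∉⊥
    ; above⇒    = λ _ → rothe⇒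
    ; ⇒above    = λ _ → ⇒rothe
    ; climber   = ⇒rothe j₃,a∈
    ; last      = a-max _ ∘ rothe⇒
    ; b⇒        = rothe⇒
    }

  -- The gap in row `j₁` guarantees a landing row, and the nearest gap is taken.
  climb : ∀ {r E} → toℕ j₁ < toℕ r → toℕ r ≤ toℕ j₃ → Climbing r E →
          ∃[ r′ ] Σ[ E′ ∈ GraveDiagram n ] toℕ r′ < toℕ r × ¬ InRothe w r′ a × Climbing r′ E′ ×
          (∀ {s} → toℕ s < toℕ r → InRothe w s a → Box E′ s a)
  climb {r} {E} j₁<r r≤j₃ C = r′ , E′ , r′<r , r′,a∉ , climbing′ , λ s<r s,a∈ →
    S.box-stays (⇒above s<r s,a∈) λ { (refl , _) → <-irrefl refl s<r }
    where
    open Climbing C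
    occ⇒box : ∀ {s k} → Occupied E s k → Box E s k
    occ⇒box occ = [ (λ b∈ → b∈) , (λ g∈ → contradiction g∈ ghostless) ]′ (occupied⇒ E occ)
    landing : ∃[ m ] IsMax (λ s → s <ᶠ r × cell s a ∉ occupied E) m
    landing = exists-max (λ s → (toℕ s <? toℕ r) ×-dec ¬? (cell s a ∈? occupied E))
      (j₁ , j₁<r , j₁,a∉ ∘ above⇒ j₁<r ∘ occ⇒box)
    r′ = proj₁ landing
    r′<r : toℕ r′ < toℕ r
    r′<r = proj₁ (proj₁ (proj₂ landing))
    r′,a∉ : ¬ InRothe w r′ a
    r′,a∉ = proj₂ (proj₁ (proj₂ landing)) ∘ box⇒occupied E ∘ ⇒above r′<r
    result = ordinary-result record
      { box        = climber
      ; rightmost  = box⇒occupied E climber , λ k → last ∘ occ⇒box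
      ; target     = proj₂ landing
      ; boxes-only = λ _ _ _ → occ⇒box
      }
    E′ = proj₁ result
    module S = Slide (proj₁ (proj₂ (proj₂ result)))
    -- Row `r′` is above the row where `w` takes the value `a`, so a gap at `(r′ , a)` forces
    -- `w r′ ≤ a` and the climber is again last in its row.
    row-ends : ∀ {k} → InRothe w r′ k → toℕ k ≤ toℕ a
    row-ends (_ , k<wr′) = ≮⇒≥ λ a<k →
      r′,a∉ (<-trans (<-≤-trans r′<r r≤j₃) (proj₁ j₃,a∈) , <-trans a<k k<wr′)
    climbing′ : Climbing r′ E′
    climbing′ = record
      { reachable = reachable ◅◅ (r , r′ , proj₁ (proj₂ result)) ◅ ε
      ; ghostless = λ {s} {k} g∈ → ghostless (subst (cell s k ∈_) (proj₂ (proj₂ (proj₂ result))) g∈)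
      ; above⇒    = λ s<r′ b∈ → [ above⇒ (<-trans s<r′ r′<r) ∘ proj₁
                                , (λ { (refl , _) → contradiction s<r′ (<-irrefl refl) }) ]′ (S.box-cases b∈)
      ; ⇒above    = λ s<r′ s,k∈ → S.box-stays (⇒above (<-trans s<r′ r′<r) s,k∈)
                                    λ { (refl , _) → <-asym s<r′ r′<r }
      ; climber   = S.box-lands
      ; last      = λ b∈ → [ row-ends ∘ above⇒ r′<r ∘ proj₁ , (λ { (_ , refl) → ≤-refl }) ]′ (S.box-cases b∈)
      ; b⇒        = λ b∈ → [ b⇒ ∘ proj₁ , (λ (_ , b≡a) → contradiction (sym b≡a) a≢b) ]′ (S.box-cases b∈)
      }

  -- The fields `b⇒`, `gain` and `no-loss` each refute one constructor of `Blocked`.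
  record Jumped (E : GraveDiagram n) : Set where
    field
      reachable : KKoh w E
      b⇒        : ∀ {s} → Box E s b → InRothe w s b
      gain      : ∃[ r ] toℕ r < toℕ j₂ × Box E r a × ¬ InRothe w r a
      no-loss   : ∀ {s} → toℕ s < toℕ j₂ → InRothe w s a → Box E s a

  -- Each climb lands in a gap of column `a`, and row `j₂` is not one, so the climber passes it
  -- without stopping there. The bound `t` on the row ensures termination.
  climb-past : ∀ t {r E} → toℕ r ≤ t → toℕ j₂ < toℕ r → toℕ r ≤ toℕ j₃ → Climbing r E →
               Σ[ E′ ∈ GraveDiagram n ] Jumped E′
  climb-past zero    r≤0 j₂<r _ _ = contradiction j₂<r (<⇒≱ (s≤s (≤-trans r≤0 z≤n)))
  climb-past (suc t) {r} r≤1+t j₂<r r≤j₃ C with climb (<-trans j₁<j₂ j₂<r) r≤j₃ C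
  ... | r′ , E′ , r′<r , r′,a∉ , C′ , keeps with <-cmp (toℕ r′) (toℕ j₂)
  ...   | tri< r′<j₂ _ _ = E′ , record
    { reachable = Climbing.reachable C′
    ; b⇒        = Climbing.b⇒ C′
    ; gain      = r′ , r′<j₂ , Climbing.climber C′ , r′,a∉
    ; no-loss   = λ s<j₂ → keeps (<-trans s<j₂ j₂<r)
    }
  ...   | tri≈ _ r′≡j₂ _ = contradiction (subst (λ s → InRothe w s a) (sym (toℕ-injective r′≡j₂)) j₂,a∈) r′,a∉
  ...   | tri> _ _ j₂<r′ =
    climb-past t (≤-pred (≤-trans r′<r r≤1+t)) j₂<r′ (≤-trans (<⇒≤ r′<r) r≤j₃) C′

  jumped : Σ[ E ∈ GraveDiagram n ] Jumped E
  jumped = climb-past (toℕ j₃) ≤-refl j₂<j₃ ≤-refl climbing-start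

  -- The obstruction to simple moves.

  -- Until the box in (j₂ , b) moves, it blocks (j₂ , a), so simple moves cannot bring a new box
  -- of column a above row j₂. The topmost change in column b, which is a gain, records that the
  -- box has moved; the bottommost change of column a above row j₂, a loss, that none arrived.
  data Blocked (E : GraveDiagram n) : Set where
    released : ∀ s → Box E s b → ¬ InRothe w s b →
               (∀ {t} → toℕ t < toℕ s → InRothe w t b → Box E t b) → Blocked E
    unchanged : (∀ {s} → InRothe w s b → Box E s b) →
                (∀ {s} → toℕ s < toℕ j₂ → Box E s a → InRothe w s a) → Blocked E
    lost      : (∀ {s} → InRothe w s b → Box E s b) →
                ∀ t → toℕ t < toℕ j₂ → InRothe w t a → ¬ Box E t a →
                (∀ {u} → toℕ t < toℕ u → toℕ u < toℕ j₂ → Box E u a → InRothe w u a) → Blocked E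

  blocked-initial : Blocked (initial w)
  blocked-initial = unchanged ⇒rothe λ _ → rothe⇒

  jumped⇒¬blocked : ∀ {E} → Jumped E → ¬ Blocked E
  jumped⇒¬blocked J (released s b∈ s,b∉ _) = s,b∉ (Jumped.b⇒ J b∈)
  jumped⇒¬blocked J (unchanged _ a⇒) = let r , r<j₂ , b∈ , r,a∉ = Jumped.gain J in r,a∉ (a⇒ r<j₂ b∈)
  jumped⇒¬blocked J (lost _ t t<j₂ t,a∈ t∉ _) = t∉ (Jumped.no-loss J t<j₂ t,a∈)

  module _ {i i′ j : Fin n} {E E′ : GraveDiagram n} (S : Slide i i′ j E E′) where

    open Slide S

    stays-other : ∀ {s k} → k ≢ j → Box E s k → Box E′ s k
    stays-other {s} k≢j b∈ = box-stays {s} b∈ (k≢j ∘ proj₂)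

    was-there : ∀ {s k} → k ≢ j ⊎ s ≢ i′ → Box E′ s k → Box E s k
    was-there ≢ b∈ with box-cases b∈ | ≢
    ... | inj₁ (b∈E , _)  | _         = b∈E
    ... | inj₂ (_ , k≡j)  | inj₁ k≢j  = contradiction k≡j k≢j
    ... | inj₂ (s≡i′ , _) | inj₂ s≢i′ = contradiction s≡i′ s≢i′

    left-behind : ¬ Box E′ i j
    left-behind b∈ = [ (λ (_ , ≢) → ≢ (refl , refl)) , (λ (i≡i′ , _) → <-irrefl (sym (cong toℕ i≡i′)) upward) ]′
                     (box-cases b∈)

    release : j ≡ b → (∀ {t} → toℕ t < toℕ i′ → InRothe w t b → Box E t b) → ¬ InRothe w i′ b → Blocked E′
    release refl ⇒b i′,b∉ = released i′ box-lands i′,b∉ λ t<i′ t,b∈ →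
      box-stays (⇒b t<i′ t,b∈) λ { (refl , _) → <-asym t<i′ upward }

    release-all : j ≡ b → (∀ {s} → InRothe w s b → Box E s b) → Blocked E′
    release-all refl ⇒b = release refl (λ _ → ⇒b) (target-empty ∘ box⇒occupied E ∘ ⇒b)

    -- All initial boxes of column `b` above `s` are in place, so a move landing above `s` in this
    -- column fills a new cell and gives a higher gain. A move landing below `s` leaves the rows
    -- down to `s` alone.
    released-step : ∀ s → Box E s b → ¬ InRothe w s b →
                    (∀ {t} → toℕ t < toℕ s → InRothe w t b → Box E t b) → Blocked E′
    released-step s b∈ s,b∉ above with j ≟ᶠ b
    ... | no j≢b = released s (stays-other (j≢b ∘ sym) b∈) s,b∉ λ t<s → stays-other (j≢b ∘ sym) ∘ above t<s
    ... | yes refl with <-cmp (toℕ i′) (toℕ s)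
    ...   | tri< i′<s _ _ = release refl (λ t<i′ → above (<-trans t<i′ i′<s))
                                    (target-empty ∘ box⇒occupied E ∘ above i′<s)
    ...   | tri≈ _ i′≡s _ = contradiction
      (box⇒occupied E (subst (λ r → Box E r b) (sym (toℕ-injective i′≡s)) b∈)) target-empty
    ...   | tri> _ _ s<i′ = released s (box-stays b∈ (λ { (refl , _) → <-asym s<i′ upward })) s,b∉
      λ t<s t,b∈ → box-stays (above t<s t,b∈) λ { (refl , _) → <-asym (<-trans t<s s<i′) upward }

    module _ (one-row : toℕ i ≡ suc (toℕ i′)) (⇒b : ∀ {s} → InRothe w s b → Box E s b) (j≢b : j ≢ b) where

      ⇒b′ : ∀ {s} → InRothe w s b → Box E′ s b
      ⇒b′ = stays-other (j≢b ∘ sym) ∘ ⇒b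

      -- The box at `(j₂ , b)` lies to the right of column `a`, so `(j₂ , a)` is not rightmost.
      not-from-j₂ : j ≡ a → i ≢ j₂
      not-from-j₂ refl refl = right-empty a<b (box⇒occupied E (⇒b j₂,b∈))

      -- Simplicity enters here: from below row `j₂` one step reaches row `j₂` at best, and
      -- `not-from-j₂` stops the next one.
      lands-low : toℕ j₂ < toℕ i → ∀ {s} → toℕ s < toℕ j₂ → s ≢ i′
      lands-low j₂<i s<j₂ refl = <⇒≱ s<j₂ (≤-pred (subst (toℕ j₂ <_) one-row j₂<i))

      -- The landing row is above `i`, so the vacated row `i` becomes the bottommost change.
      lose : j ≡ a → toℕ i < toℕ j₂ →
             (∀ {u} → toℕ i ≤ toℕ u → toℕ u < toℕ j₂ → Box E u a → InRothe w u a) → Blocked E′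
      lose refl i<j₂ a⇒ = lost ⇒b′ i i<j₂ (a⇒ ≤-refl i<j₂ box) left-behind λ i<u u<j₂ b∈ →
        a⇒ (<⇒≤ i<u) u<j₂ (was-there (inj₂ λ { refl → <-asym i<u upward }) b∈)

      unchanged-step : (∀ {s} → toℕ s < toℕ j₂ → Box E s a → InRothe w s a) → Blocked E′
      unchanged-step a⇒ with j ≟ᶠ a
      ... | no j≢a = unchanged ⇒b′ λ s<j₂ → a⇒ s<j₂ ∘ was-there (inj₁ (j≢a ∘ sym))
      ... | yes j≡a with <-cmp (toℕ i) (toℕ j₂)
      ...   | tri< i<j₂ _ _ = lose j≡a i<j₂ λ _ → a⇒
      ...   | tri≈ _ i≡j₂ _ = contradiction (toℕ-injective i≡j₂) (not-from-j₂ j≡a)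
      ...   | tri> _ _ j₂<i = unchanged ⇒b′ λ s<j₂ → a⇒ s<j₂ ∘ was-there (inj₂ (lands-low j₂<i s<j₂))

      lost-step : ∀ t → toℕ t < toℕ j₂ → InRothe w t a → ¬ Box E t a →
                  (∀ {u} → toℕ t < toℕ u → toℕ u < toℕ j₂ → Box E u a → InRothe w u a) → Blocked E′
      lost-step t t<j₂ t,a∈ t∉ a⇒ with j ≟ᶠ a
      ... | no j≢a = lost ⇒b′ t t<j₂ t,a∈ (t∉ ∘ was-there (inj₁ (j≢a ∘ sym)))
                       λ t<u u<j₂ → a⇒ t<u u<j₂ ∘ was-there (inj₁ (j≢a ∘ sym))
      ... | yes j≡a with <-cmp (toℕ i) (toℕ j₂)
      ...   | tri≈ _ i≡j₂ _ = contradiction (toℕ-injective i≡j₂) (not-from-j₂ j≡a)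
      ...   | tri> _ _ j₂<i = lost ⇒b′ t t<j₂ t,a∈ (t∉ ∘ was-there (inj₂ (lands-low j₂<i t<j₂)))
                                λ t<u u<j₂ → a⇒ t<u u<j₂ ∘ was-there (inj₂ (lands-low j₂<i u<j₂))
      -- A move starting below `t` makes its own row the new bottommost loss. One starting above `t`
      -- also lands above it, and so cannot refill the loss.
      ...   | tri< i<j₂ _ _ with <-cmp (toℕ i) (toℕ t)
      ...     | tri> _ _ t<i = lose j≡a i<j₂ λ i≤u → a⇒ (<-≤-trans t<i i≤u)
      ...     | tri≈ _ i≡t _ = contradiction
        (subst₂ (Box E) (toℕ-injective i≡t) j≡a box) t∉
      ...     | tri< i<t _ _ = lost ⇒b′ t t<j₂ t,a∈
        (t∉ ∘ was-there (inj₂ λ { refl → <-asym i<t upward }))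
        λ t<u u<j₂ → a⇒ t<u u<j₂ ∘ was-there (inj₂ λ { refl → <-asym (<-trans i<t t<u) upward })

    blocked-step : toℕ i ≡ suc (toℕ i′) → Blocked E → Blocked E′
    blocked-step one-row (released s b∈ s,b∉ above) = released-step s b∈ s,b∉ above
    blocked-step one-row (unchanged ⇒b a⇒) with j ≟ᶠ b
    ... | yes j≡b = release-all j≡b ⇒b
    ... | no j≢b  = unchanged-step one-row ⇒b j≢b a⇒
    blocked-step one-row (lost ⇒b t t<j₂ t,a∈ t∉ a⇒) with j ≟ᶠ b
    ... | yes j≡b = release-all j≡b ⇒b
    ... | no j≢b  = lost-step one-row ⇒b j≢b t t<j₂ t,a∈ t∉ a⇒

  simple⇒blocked : ∀ {E E′} → Blocked E → Star SimpleMove E E′ → Blocked E′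
  simple⇒blocked B ε = B
  simple⇒blocked B ((_ , _ , move , one-row) ◅ path) =
    simple⇒blocked (blocked-step (proj₂ (slide move)) one-row B) path

  KKoh⊈SKKoh : ¬ (∀ {E} → KKoh w E → SKKoh w E)
  KKoh⊈SKKoh KKoh⊆ = let _ , J = jumped in
    jumped⇒¬blocked J (simple⇒blocked blocked-initial (KKoh⊆ (Jumped.reachable J)))

theorem5p7 : ∀ (n : ℕ) (w : Permutation′ n) → Avoids1432 w ⇔ (SKKoh w ≐ KKoh w)
theorem5p7 n w = mk⇔
  (λ avoids → (λ {E} → SKKoh⊆KKoh w {E}) , λ {E} → KKoh⊆SKKoh w avoids {E})
  λ (_ , KKoh⊆) (_ , _ , _ , _ , (j₁<j₂ , j₂<j₃ , j₃<j₄) , (w₁<w₄ , w₄<w₃ , w₃<w₂)) →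
    Jump.KKoh⊈SKKoh w j₁<j₂ j₂<j₃ j₃<j₄ w₁<w₄ w₄<w₃ w₃<w₂ (λ {E} → KKoh⊆ {E})
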